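{- Let $F$ be a one-dimensional tropical fan in $\mathbb{R}^n$ whose rays span $\mathbb{R}^n$, with primitive generators $v_1,\dots,v_q$ and weights $\omega_1,\dots,\omega_q$. Let $l\in(\mathbb{Z}^n)^\vee$ and let $L=\max(0,l)$ be such that $L\cdot F=1$. Then $g(F,L)$ is a set of two rays $\{\mathbb{R}_+v_a,\mathbb{R}_+v_b\}$ such that: - $l(v_a)=1$, $l(v_b)=-1$ and $\omega_a=\omega_b=1$; - $l(v_i)=0$ for all $i\ne a,b$.
   Context: A one-dimensional tropical fan $F$ in $\mathbb{R}^n$ consists of finitely many distinct rays $\mathbb{R}_+v_1,\dots,\mathbb{R}_+v_q$ (and the origin), with $v_i\in\mathbb{Z}^n$ primitive, together with positive integer weights $\omega_1,\dots,\omega_q$ satisfying the balancing condition $\sum_i\omega_iv_i=0$. For $L=\max(0,l)$ with $l\in(\mathbb{Z}^n)^\vee$, the intersection number is $L\cdot F=\sum_{i=1}^q\omega_iL(v_i)$. If $L\cdot F=1$, the gallery of $F$ over $L$ is the set of rays $g(F,L)=\{\mathbb{R}_+v_i: L(v_i)+L(-v_i)=1\}$ (i.e. the rays whose spanned line, with weight $1$, has intersection number $1$ with $L$). -}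

module Defs where

open import Algebra.Bundles using (RawRing)
open import Algebra.Module.Bundles using (RawLeftModule)
import Algebra.Module.Construct.TensorUnit as TensorUnit
open import Algebra.Module.Morphism.Structures using (module LeftModuleMorphisms)
import Algebra.Definitions.RawMonoid as RawMonoidDefinitions
open import Data.Fin using (Fin)
open import Data.Integer as ℤ using (ℤ; 0ℤ)
import Data.Integer.Divisibility as ℤ
import Data.Integer.Properties as ℤ
open import Data.Nat as ℕ using (ℕ)
import Data.Nat.Properties as ℕ
open import Data.Product using (_×_; _,_; ∃-syntax; Σ-syntax)
open import Data.Rational as ℚ using (ℚ; 0ℚ; 1ℚ; ½)
import Data.Rational.Properties as ℚ
open import Data.Rational.Solver using (module +-*-Solver)
open import Data.Vec.Functional using (Vector)
open import Data.Vec.Functional.Relation.Binary.Pointwise using (Pointwise)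
open import Level using (0ℓ)
open import Relation.Binary.PropositionalEquality using (_≡_; _≢_; refl; sym; trans; cong; cong₂; subst)
open import Relation.Nullary using (¬_)
open import Relation.Unary using (Pred; _≐_)

-- The reals are Cauchy sequences of rationals; equality of reals is _≃_, not _≡_.

Eventually : Pred ℕ 0ℓ → Set
Eventually P = ∃[ N ] ∀ n → N ℕ.≤ n → P n

IsCauchy : (ℕ → ℚ) → Set
IsCauchy x = ∀ ε → 0ℚ ℚ.< ε →
  ∃[ N ] ∀ m n → N ℕ.≤ m → N ℕ.≤ n → ℚ.∣ x m ℚ.- x n ∣ ℚ.< ε

record ℝ : Set where
  constructor mkℝ
  field
    seq    : ℕ → ℚ
    cauchy : IsCauchy seq

open ℝ public

infix 4 _≃_ _≤ᴿ_

_≃_ : ℝ → ℝ → Set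
x ≃ y = ∀ ε → 0ℚ ℚ.< ε → Eventually λ n → ℚ.∣ seq x n ℚ.- seq y n ∣ ℚ.< ε

_≤ᴿ_ : ℝ → ℝ → Set
x ≤ᴿ y = ∀ ε → 0ℚ ℚ.< ε → Eventually λ n → seq x n ℚ.< seq y n ℚ.+ ε

private
  open ℚ.≤-Reasoning

  half-pos : ∀ {ε} → 0ℚ ℚ.< ε → 0ℚ ℚ.< ½ ℚ.* ε
  half-pos {ε} 0<ε = ℚ.positive⁻¹ (½ ℚ.* ε)
    {{ℚ.pos*pos⇒pos ½ ε {{ℚ.positive 0<ε}}}}

  half+half : ∀ ε → ½ ℚ.* ε ℚ.+ ½ ℚ.* ε ≡ ε
  half+half ε = trans (sym (ℚ.*-distribʳ-+ ε ½ ½)) (ℚ.*-identityˡ ε)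

  +-cauchy : ∀ {x y} → IsCauchy x → IsCauchy y → IsCauchy (λ n → x n ℚ.+ y n)
  +-cauchy {x} {y} cx cy ε 0<ε
    with cx (½ ℚ.* ε) (half-pos 0<ε) | cy (½ ℚ.* ε) (half-pos 0<ε)
  ... | M , hx | N , hy = M ℕ.⊔ N , λ m n M⊔N≤m M⊔N≤n → begin-strict
    ℚ.∣ (x m ℚ.+ y m) ℚ.- (x n ℚ.+ y n) ∣
      ≡⟨ cong ℚ.∣_∣ (rearrange (x m) (y m) (x n) (y n)) ⟩
    ℚ.∣ (x m ℚ.- x n) ℚ.+ (y m ℚ.- y n) ∣
      ≤⟨ ℚ.∣p+q∣≤∣p∣+∣q∣ (x m ℚ.- x n) (y m ℚ.- y n) ⟩
    ℚ.∣ x m ℚ.- x n ∣ ℚ.+ ℚ.∣ y m ℚ.- y n ∣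
      <⟨ ℚ.+-mono-<
           (hx m n (ℕ.m⊔n≤o⇒m≤o M N M⊔N≤m) (ℕ.m⊔n≤o⇒m≤o M N M⊔N≤n))
           (hy m n (ℕ.m⊔n≤o⇒n≤o M N M⊔N≤m) (ℕ.m⊔n≤o⇒n≤o M N M⊔N≤n)) ⟩
    ½ ℚ.* ε ℚ.+ ½ ℚ.* ε
      ≡⟨ half+half ε ⟩
    ε ∎
    where
    rearrange : ∀ a b c d → (a ℚ.+ b) ℚ.- (c ℚ.+ d) ≡ (a ℚ.- c) ℚ.+ (b ℚ.- d)
    rearrange = solve 4 (λ a b c d → (a :+ b) :- (c :+ d) := (a :- c) :+ (b :- d)) refl
      where open +-*-Solver

  neg-cauchy : ∀ {x} → IsCauchy x → IsCauchy (λ n → ℚ.- x n)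
  neg-cauchy {x} cx ε 0<ε with cx ε 0<ε
  ... | N , hx = N , λ m n N≤m N≤n → begin-strict
    ℚ.∣ (ℚ.- x m) ℚ.- (ℚ.- x n) ∣ ≡⟨ cong ℚ.∣_∣ (rearrange (x m) (x n)) ⟩
    ℚ.∣ ℚ.- (x m ℚ.- x n) ∣        ≡⟨ ℚ.∣-p∣≡∣p∣ (x m ℚ.- x n) ⟩
    ℚ.∣ x m ℚ.- x n ∣              <⟨ hx m n N≤m N≤n ⟩
    ε ∎
    where
    rearrange : ∀ a b → (ℚ.- a) ℚ.- (ℚ.- b) ≡ ℚ.- (a ℚ.- b)
    rearrange = solve 2 (λ a b → (:- a) :- (:- b) := :- (a :- b)) refl
      where open +-*-Solver

  eventually-bounded : ∀ {x} → IsCauchy x →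
    ∃[ B ] 0ℚ ℚ.< B × Eventually λ n → ℚ.∣ x n ∣ ℚ.≤ B
  eventually-bounded {x} cx with cx 1ℚ (ℚ.positive⁻¹ 1ℚ)
  ... | N , hx =
    1ℚ ℚ.+ ℚ.∣ x N ∣ ,
    ℚ.+-mono-<-≤ (ℚ.positive⁻¹ 1ℚ) (ℚ.0≤∣p∣ (x N)) ,
    N , λ n N≤n → begin
      ℚ.∣ x n ∣                          ≡⟨ cong ℚ.∣_∣ (rearrange (x n) (x N)) ⟩
      ℚ.∣ (x n ℚ.- x N) ℚ.+ x N ∣        ≤⟨ ℚ.∣p+q∣≤∣p∣+∣q∣ (x n ℚ.- x N) (x N) ⟩
      ℚ.∣ x n ℚ.- x N ∣ ℚ.+ ℚ.∣ x N ∣    ≤⟨ ℚ.+-monoˡ-≤ ℚ.∣ x N ∣ (ℚ.<⇒≤ (hx n N N≤n ℕ.≤-refl)) ⟩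
      1ℚ ℚ.+ ℚ.∣ x N ∣ ∎
    where
    rearrange : ∀ a b → a ≡ (a ℚ.- b) ℚ.+ b
    rearrange = solve 2 (λ a b → a := (a :- b) :+ b) refl
      where open +-*-Solver

  quotient : ∀ {ε B} → 0ℚ ℚ.< ε → 0ℚ ℚ.< B → ∃[ δ ] 0ℚ ℚ.< δ × B ℚ.* δ ≡ ε
  quotient {ε} {B} 0<ε 0<B =
    δ , ℚ.positive⁻¹ δ {{ℚ.pos*pos⇒pos (ℚ.1/ B) {{ℚ.1/pos⇒pos B}} ε {{ℚ.positive 0<ε}}}} , (begin-equality
      B ℚ.* (ℚ.1/ B ℚ.* ε)   ≡⟨ sym (ℚ.*-assoc B (ℚ.1/ B) ε) ⟩
      (B ℚ.* ℚ.1/ B) ℚ.* ε   ≡⟨ cong (ℚ._* ε) (ℚ.*-inverseʳ B) ⟩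
      1ℚ ℚ.* ε               ≡⟨ ℚ.*-identityˡ ε ⟩
      ε ∎)
    where
    instance
      B-pos : ℚ.Positive B
      B-pos = ℚ.positive 0<B
      B-nonZero : ℚ.NonZero B
      B-nonZero = ℚ.pos⇒nonZero B
    δ = ℚ.1/ B ℚ.* ε

  *-bound : ∀ {p q B δ} → 0ℚ ℚ.< B → ℚ.∣ p ∣ ℚ.≤ B → ℚ.∣ q ∣ ℚ.< δ →
    ℚ.∣ p ℚ.* q ∣ ℚ.< B ℚ.* δ
  *-bound {p} {q} {B} {δ} 0<B p≤B q<δ = begin-strict
    ℚ.∣ p ℚ.* q ∣          ≡⟨ ℚ.∣p*q∣≡∣p∣*∣q∣ p q ⟩
    ℚ.∣ p ∣ ℚ.* ℚ.∣ q ∣    ≤⟨ ℚ.*-monoʳ-≤-nonNeg ℚ.∣ q ∣ {{ℚ.∣-∣-nonNeg q}} p≤B ⟩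
    B ℚ.* ℚ.∣ q ∣          <⟨ ℚ.*-monoʳ-<-pos B {{ℚ.positive 0<B}} q<δ ⟩
    B ℚ.* δ ∎

  *-close : ∀ {a b c d A B α β} → 0ℚ ℚ.< A → 0ℚ ℚ.< B →
    ℚ.∣ a ∣ ℚ.≤ A → ℚ.∣ d ∣ ℚ.≤ B → ℚ.∣ b ℚ.- d ∣ ℚ.< α → ℚ.∣ a ℚ.- c ∣ ℚ.< β →
    ℚ.∣ a ℚ.* b ℚ.- c ℚ.* d ∣ ℚ.< A ℚ.* α ℚ.+ B ℚ.* β
  *-close {a} {b} {c} {d} {A} {B} {α} {β} 0<A 0<B a≤A d≤B b~d a~c = begin-strict
    ℚ.∣ a ℚ.* b ℚ.- c ℚ.* d ∣
      ≡⟨ cong ℚ.∣_∣ (rearrange a b c d) ⟩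
    ℚ.∣ a ℚ.* (b ℚ.- d) ℚ.+ d ℚ.* (a ℚ.- c) ∣
      ≤⟨ ℚ.∣p+q∣≤∣p∣+∣q∣ (a ℚ.* (b ℚ.- d)) (d ℚ.* (a ℚ.- c)) ⟩
    ℚ.∣ a ℚ.* (b ℚ.- d) ∣ ℚ.+ ℚ.∣ d ℚ.* (a ℚ.- c) ∣
      <⟨ ℚ.+-mono-< (*-bound {a} {b ℚ.- d} 0<A a≤A b~d) (*-bound {d} {a ℚ.- c} 0<B d≤B a~c) ⟩
    A ℚ.* α ℚ.+ B ℚ.* β ∎
    where
    rearrange : ∀ a b c d →
      a ℚ.* b ℚ.- c ℚ.* d ≡ a ℚ.* (b ℚ.- d) ℚ.+ d ℚ.* (a ℚ.- c)
    rearrange = solve 4 (λ a b c d →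
      a :* b :- c :* d := a :* (b :- d) :+ d :* (a :- c)) refl
      where open +-*-Solver

  *-cauchy : ∀ {x y} → IsCauchy x → IsCauchy y → IsCauchy (λ n → x n ℚ.* y n)
  *-cauchy {x} {y} cx cy ε 0<ε =
    let A , 0<A , K , x≤A = eventually-bounded cx
        B , 0<B , L , y≤B = eventually-bounded cy
        α , 0<α , Aα≡ε/2  = quotient (half-pos 0<ε) 0<A
        β , 0<β , Bβ≡ε/2  = quotient (half-pos 0<ε) 0<B
        M , hx = cx β 0<β
        N , hy = cy α 0<α
        KL = K ℕ.⊔ L
        MN = M ℕ.⊔ N
    in KL ℕ.⊔ MN , λ m n ≤m ≤n →
      let KL≤m = ℕ.m⊔n≤o⇒m≤o KL MN ≤m
          KL≤n = ℕ.m⊔n≤o⇒m≤o KL MN ≤n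
          MN≤m = ℕ.m⊔n≤o⇒n≤o KL MN ≤m
          MN≤n = ℕ.m⊔n≤o⇒n≤o KL MN ≤n
      in subst (ℚ.∣ x m ℚ.* y m ℚ.- x n ℚ.* y n ∣ ℚ.<_)
           (trans (cong₂ ℚ._+_ Aα≡ε/2 Bβ≡ε/2) (half+half ε))
           (*-close {x m} {y m} {x n} {y n} 0<A 0<B
             (x≤A m (ℕ.m⊔n≤o⇒m≤o K L KL≤m))
             (y≤B n (ℕ.m⊔n≤o⇒n≤o K L KL≤n))
             (hy m n (ℕ.m⊔n≤o⇒n≤o M N MN≤m) (ℕ.m⊔n≤o⇒n≤o M N MN≤n))
             (hx m n (ℕ.m⊔n≤o⇒m≤o M N MN≤m) (ℕ.m⊔n≤o⇒m≤o M N MN≤n)))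

fromℚ : ℚ → ℝ
fromℚ p = mkℝ (λ _ → p) λ ε 0<ε → 0 , λ _ _ _ _ →
  subst (ℚ._< ε) (sym (cong ℚ.∣_∣ (ℚ.+-inverseʳ p))) 0<ε

ℝ-rawRing : RawRing 0ℓ 0ℓ
ℝ-rawRing = record
  { Carrier = ℝ
  ; _≈_ = _≃_
  ; _+_ = λ x y → mkℝ (λ n → seq x n ℚ.+ seq y n) (+-cauchy {seq x} {seq y} (cauchy x) (cauchy y))
  ; _*_ = λ x y → mkℝ (λ n → seq x n ℚ.* seq y n) (*-cauchy {seq x} {seq y} (cauchy x) (cauchy y))
  ; -_  = λ x → mkℝ (λ n → ℚ.- seq x n) (neg-cauchy {seq x} (cauchy x))
  ; 0#  = fromℚ 0ℚ
  ; 1#  = fromℚ 1ℚ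
  }

freeModule : (R : RawRing 0ℓ 0ℓ) → ℕ → RawLeftModule (RawRing.Carrier R) 0ℓ 0ℓ
freeModule R n = record
  { Carrierᴹ = Vector Carrier n
  ; _≈ᴹ_ = Pointwise _≈_
  ; _+ᴹ_ = λ u v i → u i + v i
  ; _*ₗ_ = λ c v i → c * v i
  ; 0ᴹ   = λ _ → 0#
  ; -ᴹ_  = λ v i → - v i
  }
  where open RawRing R

ℤ^ : ℕ → RawLeftModule ℤ 0ℓ 0ℓ
ℤ^ = freeModule ℤ.+-*-rawRing

ℝ^ : ℕ → RawLeftModule ℝ 0ℓ 0ℓ
ℝ^ = freeModule ℝ-rawRing

ℤVec : ℕ → Set
ℤVec n = RawLeftModule.Carrierᴹ (ℤ^ n)

ℝVec : ℕ → Set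
ℝVec n = RawLeftModule.Carrierᴹ (ℝ^ n)

ι : ∀ {n} → ℤVec n → ℝVec n
ι v j = fromℚ (v j ℚ./ 1)

record Dual (n : ℕ) : Set where
  open LeftModuleMorphisms (ℤ^ n)
    (TensorUnit.rawLeftModule {R = ℤ.+-*-rawRing})
  field
    apply    : ℤVec n → ℤ
    isLinear : IsLeftModuleHomomorphism apply

open Dual public using (apply)

-- The zero vector is not primitive, since every d divides its coordinates.
Primitive : ∀ {n} → ℤVec n → Set
Primitive v = ∀ d → (∀ j → d ℤ.∣ v j) → ℤ.∣ d ∣ ≡ 1

ray : ∀ {n} → ℤVec n → Pred (ℝVec n) 0ℓ
ray {n} v x = ∃[ t ] fromℚ 0ℚ ≤ᴿ t × x ≈ᴹ t *ₗ ι v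
  where open RawLeftModule (ℝ^ n)

record TropicalFan (n : ℕ) : Set where
  open RawLeftModule (ℤ^ n)
  open RawMonoidDefinitions +ᴹ-rawMonoid using (sum)
  field
    q           : ℕ
    v           : Fin q → ℤVec n
    ω           : Fin q → ℤ
    v-primitive : ∀ i → Primitive (v i)
    v-distinct  : ∀ {i j} → i ≢ j → ¬ (ray (v i) ≐ ray (v j))
    ω-positive  : ∀ i → ℤ.Positive (ω i)
    balanced    : sum (λ i → ω i *ₗ v i) ≈ᴹ 0ᴹ

RaysSpan : ∀ {n} → TropicalFan n → Set
RaysSpan {n} F = ∀ (w : ℝVec n) → Σ[ c ∈ Vector ℝ q ] w ≈ᴹ sum (λ i → c i *ₗ ι (v i))
  where
  open TropicalFan F
  open RawLeftModule (ℝ^ n)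
  open RawMonoidDefinitions +ᴹ-rawMonoid using (sum)

tropicalMax : ∀ {n} → Dual n → ℤVec n → ℤ
tropicalMax l u = 0ℤ ℤ.⊔ apply l u

infix 7 _·_

_·_ : ∀ {n} → (ℤVec n → ℤ) → TropicalFan n → ℤ
L · F = sum (λ i → ω i ℤ.* L (v i))
  where
  open TropicalFan F
  open RawMonoidDefinitions ℤ.+-0-rawMonoid using (sum)

-- A ray is a subset of ℝⁿ, so membership in a set of rays is taken up to
-- equality _≐_ of subsets.
gallery : ∀ {n} → TropicalFan n → (ℤVec n → ℤ) → Pred (Pred (ℝVec n) 0ℓ) 0ℓ
gallery {n} F L ρ = ∃[ i ] ρ ≐ ray (v i) × L (v i) ℤ.+ L (-ᴹ v i) ≡ ℤ.1ℤ
  where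
  open TropicalFan F
  open RawLeftModule (ℤ^ n)

{-# OPTIONS --safe #-}

-- Balancing gives Σ ωᵢ l(vᵢ) = 0, so max(0, l) and max(0, − l) have the same intersection number 1 with F.
-- Each of these is a sum of nonnegative integers equal to 1, hence has exactly one nonzero term, which is 1:
-- the first sum singles out a, the second singles out b, and l vanishes on every other generator.
module Submission where

open import Defs
open import Algebra.Module.Morphism.Structures using (module LeftModuleMorphisms)
import Algebra.Definitions.RawMonoid as RawMonoidDefinitions
open import Algebra.Module.Bundles using (RawLeftModule)
import Algebra.Properties.CommutativeMonoid.Sum as CommutativeMonoidSum
open import Data.Fin using (Fin; zero; suc; _≟_)
open import Data.Integer using (ℤ; +_; -[1+_]; 0ℤ; 1ℤ; -1ℤ; _+_; _*_; -_; _⊔_; _≤_; Positive; +[1+_]; +≤+)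
import Data.Integer.Properties as ℤ
open import Data.Nat using (ℕ; zero; suc)
import Data.Nat.Properties as ℕ
open import Data.Product using (_×_; _,_; ∃-syntax)
open import Data.Sum as Sum using (_⊎_; inj₁; inj₂; [_,_]′)
open import Function using (_∘_)
open import Relation.Binary.PropositionalEquality using (_≡_; _≢_; refl; sym; trans; cong; cong₂; subst; module ≡-Reasoning)
open import Relation.Nullary using (¬_; yes; no; contradiction)
open import Relation.Unary using (_≐_)

open CommutativeMonoidSum ℤ.+-0-commutativeMonoid using (sum; sum-cong-≗; ∑-distrib-+)

positivePart-≡ : ∀ i → 0ℤ ⊔ i ≡ (0ℤ ⊔ (- i)) + i
positivePart-≡ (+ zero) = refl
positivePart-≡ +[1+ n ] = sym (ℤ.+-identityˡ +[1+ n ])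
positivePart-≡ -[1+ n ] = sym (ℤ.+-inverseˡ -[1+ n ])

0⊔i≡1⇒i≡1 : ∀ i → 0ℤ ⊔ i ≡ 1ℤ → i ≡ 1ℤ
0⊔i≡1⇒i≡1 (+ n) eq = eq

0⊔±i≡0⇒i≡0 : ∀ i → 0ℤ ⊔ i ≡ 0ℤ → 0ℤ ⊔ (- i) ≡ 0ℤ → i ≡ 0ℤ
0⊔±i≡0⇒i≡0 i i⁺≡0 i⁻≡0 = begin
  i                     ≡⟨ sym (ℤ.+-identityˡ i) ⟩
  0ℤ + i                ≡⟨ cong (_+ i) (sym i⁻≡0) ⟩
  (0ℤ ⊔ (- i)) + i      ≡⟨ sym (positivePart-≡ i) ⟩
  0ℤ ⊔ i                ≡⟨ i⁺≡0 ⟩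
  0ℤ                    ∎
  where open ≡-Reasoning

pos*nonNeg≡1 : ∀ i j → Positive i → 0ℤ ≤ j → i * j ≡ 1ℤ → i ≡ 1ℤ × j ≡ 1ℤ
pos*nonNeg≡1 +[1+ m ] (+ n) _ (+≤+ _) eq =
  cong +_ (ℕ.m*n≡1⇒m≡1 (suc m) n mn≡1) , cong +_ (ℕ.m*n≡1⇒n≡1 (suc m) n mn≡1)
  where mn≡1 = ℤ.+-injective (trans (ℤ.pos-* (suc m) n) eq)

pos*j≡0⇒j≡0 : ∀ i j → Positive i → i * j ≡ 0ℤ → j ≡ 0ℤ
pos*j≡0⇒j≡0 i@(+[1+ _ ]) j _ eq with ℤ.i*j≡0⇒i≡0∨j≡0 i eq
... | inj₂ j≡0 = j≡0

0≤pos*nonNeg : ∀ i j → Positive i → 0ℤ ≤ j → 0ℤ ≤ i * j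
0≤pos*nonNeg i@(+[1+ _ ]) j _ 0≤j = subst (_≤ i * j) (ℤ.*-zeroʳ i) (ℤ.*-monoˡ-≤-nonNeg i 0≤j)

sum-nonNeg : ∀ {q} (f : Fin q → ℤ) → (∀ i → 0ℤ ≤ f i) → 0ℤ ≤ sum f
sum-nonNeg {zero}  f f≥0 = ℤ.≤-refl
sum-nonNeg {suc q} f f≥0 = ℤ.+-mono-≤ (f≥0 zero) (sum-nonNeg (f ∘ suc) (f≥0 ∘ suc))

nonNeg-+≡0 : ∀ {i j} → 0ℤ ≤ i → 0ℤ ≤ j → i + j ≡ 0ℤ → i ≡ 0ℤ × j ≡ 0ℤ
nonNeg-+≡0 {+ zero} {+ n} _ _ eq = refl , eq

nonNeg-+≡1 : ∀ {i j} → 0ℤ ≤ i → 0ℤ ≤ j → i + j ≡ 1ℤ → i ≡ 1ℤ × j ≡ 0ℤ ⊎ i ≡ 0ℤ × j ≡ 1ℤ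
nonNeg-+≡1 {+ zero}     {+ n}    _ _ eq = inj₂ (refl , eq)
nonNeg-+≡1 {+ suc zero} {+ zero} _ _ eq = inj₁ (refl , refl)

sum≡0⇒all≡0 : ∀ {q} (f : Fin q → ℤ) → (∀ i → 0ℤ ≤ f i) → sum f ≡ 0ℤ → ∀ i → f i ≡ 0ℤ
sum≡0⇒all≡0 {suc q} f f≥0 eq i
  with nonNeg-+≡0 (f≥0 zero) (sum-nonNeg (f ∘ suc) (f≥0 ∘ suc)) eq | i
... | f₀≡0 , _    | zero  = f₀≡0
... | _ , tail≡0  | suc j = sum≡0⇒all≡0 (f ∘ suc) (f≥0 ∘ suc) tail≡0 j

sum≡1⇒unique≢0 : ∀ {q} (f : Fin q → ℤ) → (∀ i → 0ℤ ≤ f i) → sum f ≡ 1ℤ →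
  ∃[ a ] f a ≡ 1ℤ × (∀ i → i ≢ a → f i ≡ 0ℤ)
sum≡1⇒unique≢0 {suc q} f f≥0 eq
  with nonNeg-+≡1 (f≥0 zero) (sum-nonNeg (f ∘ suc) (f≥0 ∘ suc)) eq
... | inj₁ (f₀≡1 , tail≡0) = zero , f₀≡1 , λ where
  zero    0≢0 → contradiction refl 0≢0
  (suc i) _   → sum≡0⇒all≡0 (f ∘ suc) (f≥0 ∘ suc) tail≡0 i
... | inj₂ (f₀≡0 , tail≡1) with sum≡1⇒unique≢0 (f ∘ suc) (f≥0 ∘ suc) tail≡1
...   | a , fa≡1 , rest = suc a , fa≡1 , λ where
  zero    _    → f₀≡0
  (suc i) i≢a  → rest i (i≢a ∘ cong suc)

weighted-positivePart≡1 : ∀ {q} (ω x : Fin q → ℤ) → (∀ i → Positive (ω i)) →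
  sum (λ i → ω i * (0ℤ ⊔ x i)) ≡ 1ℤ →
  ∃[ a ] ω a ≡ 1ℤ × x a ≡ 1ℤ × (∀ i → i ≢ a → 0ℤ ⊔ x i ≡ 0ℤ)
weighted-positivePart≡1 ω x ω>0 eq
  with sum≡1⇒unique≢0 _ (λ i → 0≤pos*nonNeg (ω i) _ (ω>0 i) (ℤ.i≤i⊔j 0ℤ (x i))) eq
... | a , fa≡1 , rest with pos*nonNeg≡1 (ω a) _ (ω>0 a) (ℤ.i≤i⊔j 0ℤ (x a)) fa≡1
...   | ωa≡1 , xa⁺≡1 =
  a , ωa≡1 , 0⊔i≡1⇒i≡1 (x a) xa⁺≡1 , λ i i≢a → pos*j≡0⇒j≡0 (ω i) _ (ω>0 i) (rest i i≢a)

module _ {n} (l : Dual n) where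
  open RawLeftModule (ℤ^ n)
  open RawMonoidDefinitions +ᴹ-rawMonoid using () renaming (sum to sumᴹ)
  open LeftModuleMorphisms.IsLeftModuleHomomorphism (Dual.isLinear l)

  apply-sum : ∀ {q} (ω : Fin q → ℤ) (u : Fin q → ℤVec n) →
    apply l (sumᴹ (λ i → ω i *ₗ u i)) ≡ sum (λ i → ω i * apply l (u i))
  apply-sum {zero}  ω u = 0ᴹ-homo
  apply-sum {suc q} ω u = trans (+ᴹ-homo _ _)
    (cong₂ _+_ (*ₗ-homo (ω zero) (u zero)) (apply-sum (ω ∘ suc) (u ∘ suc)))

  apply-balanced : (F : TropicalFan n) → let open TropicalFan F in
    sum (λ i → ω i * apply l (v i)) ≡ 0ℤ
  apply-balanced F = trans (sym (apply-sum ω v)) (trans (⟦⟧-cong balanced) 0ᴹ-homo)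
    where open TropicalFan F

  ·-opposite : (F : TropicalFan n) → let open TropicalFan F in
    sum (λ i → ω i * (0ℤ ⊔ (- apply l (v i)))) ≡ tropicalMax l · F
  ·-opposite F = begin
    sum (λ i → ω i * x⁻ i)                             ≡⟨ sym (ℤ.+-identityʳ _) ⟩
    sum (λ i → ω i * x⁻ i) + 0ℤ                        ≡⟨ cong (λ s → sum (λ i → ω i * x⁻ i) + s) (sym (apply-balanced F)) ⟩
    sum (λ i → ω i * x⁻ i) + sum (λ i → ω i * x i)     ≡⟨ sym (∑-distrib-+ (λ i → ω i * x⁻ i) (λ i → ω i * x i)) ⟩
    sum (λ i → ω i * x⁻ i + ω i * x i)                 ≡⟨ sum-cong-≗ (λ i → trans (sym (ℤ.*-distribˡ-+ (ω i) (x⁻ i) (x i)))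
                                                            (cong (ω i *_) (sym (positivePart-≡ (x i))))) ⟩
    sum (λ i → ω i * (0ℤ ⊔ x i))                       ∎
    where
    open ≡-Reasoning
    open TropicalFan F
    x x⁻ : Fin q → ℤ
    x i  = apply l (v i)
    x⁻ i = 0ℤ ⊔ (- x i)

  width : ∀ u {k} → apply l u ≡ k → tropicalMax l u + tropicalMax l (-ᴹ u) ≡ (0ℤ ⊔ k) + (0ℤ ⊔ (- k))
  width u refl = cong (λ k → tropicalMax l u + (0ℤ ⊔ k)) (-ᴹ-homo u)

  gallery-≐ : (F : TropicalFan n) → let open TropicalFan F in
    ∀ {a b} → apply l (v a) ≡ 1ℤ → apply l (v b) ≡ -1ℤ →
    (∀ i → i ≢ a → i ≢ b → apply l (v i) ≡ 0ℤ) →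
    gallery F (tropicalMax l) ≐ (λ ρ → ρ ≐ ray (v a) ⊎ ρ ≐ ray (v b))
  gallery-≐ F {a} {b} xa≡1 xb≡-1 x≡0 =
    (λ {ρ} (i , ρ≐ , width≡1) → Sum.map
      (λ i≡a → subst (λ j → ρ ≐ ray (v j)) i≡a ρ≐)
      (λ i≡b → subst (λ j → ρ ≐ ray (v j)) i≡b ρ≐)
      (width≡1⇒a⊎b i width≡1)) ,
    [ (λ ρ≐ → a , ρ≐ , width (v a) xa≡1) , (λ ρ≐ → b , ρ≐ , width (v b) xb≡-1) ]′
    where
    open TropicalFan F
    width≡1⇒a⊎b : ∀ i → tropicalMax l (v i) + tropicalMax l (-ᴹ (v i)) ≡ 1ℤ → i ≡ a ⊎ i ≡ b
    width≡1⇒a⊎b i width≡1 with i ≟ a | i ≟ b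
    ... | yes i≡a | _       = inj₁ i≡a
    ... | no _    | yes i≡b = inj₂ i≡b
    ... | no i≢a  | no i≢b  =
      contradiction (trans (sym (width (v i) (x≡0 i i≢a i≢b))) width≡1) λ ()

lemma3p3 : (n : ℕ) (F : TropicalFan n) → RaysSpan F → (l : Dual n) →
    let open TropicalFan F
        L = tropicalMax l
    in L · F ≡ 1ℤ →
       ∃[ a ] ∃[ b ]
         ¬ (ray (v a) ≐ ray (v b)) ×
         gallery F L ≐ (λ ρ → ρ ≐ ray (v a) ⊎ ρ ≐ ray (v b)) ×
         apply l (v a) ≡ 1ℤ × apply l (v b) ≡ -1ℤ ×
         ω a ≡ 1ℤ × ω b ≡ 1ℤ ×
         (∀ i → i ≢ a → i ≢ b → apply l (v i) ≡ 0ℤ)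
lemma3p3 n F _ l L·F≡1 =
  let open TropicalFan F
      x = apply l ∘ v
      a , ωa≡1 , xa≡1 , x⁺≡0 = weighted-positivePart≡1 ω x ω-positive L·F≡1
      b , ωb≡1 , -xb≡1 , x⁻≡0 = weighted-positivePart≡1 ω (-_ ∘ x) ω-positive
                                  (trans (·-opposite l F) L·F≡1)
      xb≡-1 = trans (sym (ℤ.neg-involutive (x b))) (cong -_ -xb≡1)
      x≡0 = λ i i≢a i≢b → 0⊔±i≡0⇒i≡0 (x i) (x⁺≡0 i i≢a) (x⁻≡0 i i≢b)
      a≢b = λ a≡b → 1≢-1 (trans (sym xa≡1) (trans (cong x a≡b) xb≡-1))
  in a , b , v-distinct a≢b , gallery-≐ l F xa≡1 xb≡-1 x≡0 , xa≡1 , xb≡-1 , ωa≡1 , ωb≡1 , x≡0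
  where
  1≢-1 : 1ℤ ≢ -1ℤ
  1≢-1 ()
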